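{- For every $n$-vertex graph $G$ that admits a join, $$\mathrm{mos}(G) \geq 2 \cdot \left\lceil \frac{n-2}{4} \right\rceil .$$ Moreover, this bound is tight even for cographs: there exist cographs admitting a join for which equality holds.
   Context: All graphs are finite, simple and undirected. A graph is called odd if every vertex has odd degree. $\mathrm{mos}(G)$ denotes the maximum number of vertices of an odd induced subgraph of $G$ (the empty graph counts as odd). A join in a graph $G$ is a partition of $V(G)$ into two non-empty sets $V_1$ and $V_2$ such that every vertex of $V_1$ is adjacent to every vertex of $V_2$; $G$ admits a join if such a partition exists. A cograph is a graph with no induced path on four vertices. -}

module Defs where

open import Data.Bool.Base using (Bool; true; false; T; _∨_)
open import Data.Bool.Properties using (∨-comm)
open import Data.Fin.Base using (Fin; zero; suc; toℕ)
open import Data.Fin.Properties using (all?)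
open import Data.Fin.Subset using (Subset; inside; outside; _∈_; ∁; Nonempty; ∣_∣)
open import Data.List.Base using (List; []; _∷_; _++_; map; filter)
open import Data.List.Extrema.Nat using (max)
open import Data.Nat.Base using (ℕ; zero; suc; _+_; _∸_; _/_; _≡ᵇ_; NonZero)
open import Data.Nat.Divisibility using (_∣_; _∣?_)
open import Data.Product.Base using (_×_; ∃-syntax; Σ-syntax)
open import Data.Vec.Base using ([]; _∷_; tabulate)
open import Function.Definitions using (Injective)
open import Relation.Binary.PropositionalEquality using (_≡_; refl)
open import Relation.Nullary using (¬_; Dec; ¬?)

⌈_/_⌉ : ℕ → (d : ℕ) .{{_ : NonZero d}} → ℕ
⌈ m / d ⌉ = (m + (d ∸ 1)) / d

record Graph (n : ℕ) : Set where
  field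
    adj        : Fin n → Fin n → Bool
    adj-sym    : ∀ u v → adj u v ≡ adj v u
    adj-irrefl : ∀ v → adj v v ≡ false

  Adj : Fin n → Fin n → Set
  Adj u v = T (adj u v)

  neighbours : Fin n → Subset n
  neighbours v = tabulate (adj v)

  degree : Fin n → ℕ
  degree v = ∣ neighbours v ∣

open Graph public

Odd : ℕ → Set
Odd k = ¬ (2 ∣ k)

odd? : ∀ k → Dec (Odd k)
odd? k = ¬? (2 ∣? k)

OddGraph : ∀ {n} → Graph n → Set
OddGraph G = ∀ v → Odd (degree G v)

oddGraph? : ∀ {n} (G : Graph n) → Dec (OddGraph G)
oddGraph? G = all? (λ v → odd? (degree G v))

-- The i-th smallest element of S.
element : ∀ {n} (S : Subset n) → Fin ∣ S ∣ → Fin n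
element (outside ∷ S) i       = suc (element S i)
element (inside  ∷ S) zero    = zero
element (inside  ∷ S) (suc i) = suc (element S i)

-- induced G S has vertex set Fin ∣ S ∣, vertex i standing for element S i.
induced : ∀ {n} → Graph n → (S : Subset n) → Graph ∣ S ∣
induced G S = record
  { adj        = λ i j → adj G (element S i) (element S j)
  ; adj-sym    = λ i j → adj-sym G (element S i) (element S j)
  ; adj-irrefl = λ i → adj-irrefl G (element S i)
  }

allSubsets : ∀ n → List (Subset n)
allSubsets zero    = [] ∷ []
allSubsets (suc n) = map (outside ∷_) (allSubsets n) ++ map (inside ∷_) (allSubsets n)

-- The default value 0 of max is attained by the empty subset.
mos : ∀ {n} → Graph n → ℕ
mos {n} G = max 0 (map ∣_∣ (filter (λ S → oddGraph? (induced G S)) (allSubsets n)))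

IsJoin : ∀ {n} → Graph n → Subset n → Subset n → Set
IsJoin G V₁ V₂ =
  V₂ ≡ ∁ V₁ × Nonempty V₁ × Nonempty V₂ × (∀ {u v} → u ∈ V₁ → v ∈ V₂ → Adj G u v)

AdmitsJoin : ∀ {n} → Graph n → Set
AdmitsJoin G = ∃[ V₁ ] ∃[ V₂ ] IsJoin G V₁ V₂

path : ∀ k → Graph k
path k = record
  { adj        = λ i j → (suc (toℕ i) ≡ᵇ toℕ j) ∨ (suc (toℕ j) ≡ᵇ toℕ i)
  ; adj-sym    = λ i j → ∨-comm (suc (toℕ i) ≡ᵇ toℕ j) (suc (toℕ j) ≡ᵇ toℕ i)
  ; adj-irrefl = λ i → irrefl (toℕ i)
  }
  where
  irrefl : ∀ m → (suc m ≡ᵇ m) ∨ (suc m ≡ᵇ m) ≡ false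
  irrefl zero    = refl
  irrefl (suc m) = irrefl m

-- G has an induced subgraph isomorphic to H.
HasInduced : ∀ {k n} → Graph k → Graph n → Set
HasInduced {k} {n} H G =
  Σ[ f ∈ (Fin k → Fin n) ] Injective _≡_ _≡_ f × (∀ i j → adj G (f i) (f j) ≡ adj H i j)

Cograph : ∀ {n} → Graph n → Set
Cograph G = ¬ HasInduced (path 4) G

{-# OPTIONS --safe #-}
module Submission where

-- Dropping at most one vertex from each side of the join, assume that both
-- sides W₁, W₂ have odd size.  By Gallai's theorem Wᵢ splits into Eᵢ and Oᵢ
-- inducing an even and an odd graph.  By the handshake lemma ∣Oᵢ∣ is even,
-- hence ∣Eᵢ∣ is odd, so both E₁ ∪ E₂ and O₁ ∪ O₂ induce odd graphs; the larger
-- one has at least (n − 2)/2 vertices.  Gallai's theorem itself is the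
-- solvability over 𝔽₂ of M y = diag M for a symmetric matrix M.
-- The bound is attained by the triangle.

open import Defs
open import Algebra.Bundles using (CommutativeRing)
open import Data.Bool.Base using (Bool; true; false; not; _∧_; _xor_)
open import Data.Bool.Properties using (_≟_; xor-∧-commutativeRing; ∧-assoc; ∧-comm; ∧-idem; ∧-zeroʳ; ∧-identityʳ; ∧-distribˡ-xor; ∧-distribʳ-xor; xor-identityʳ; xor-inverseˡ; xor-inverseʳ; xor-same; not-involutive; ¬-not; T-≡)
open import Data.Fin.Base using (Fin; zero; suc; punchIn; punchOut)
open import Data.Fin.Properties as Fin using (any?; punchIn-punchOut; pigeonhole)
open import Data.Fin.Subset using (Subset; inside; outside; _∈_; ∁; Nonempty; ∣_∣)
open import Data.Fin.Subset.Properties using (∣∁p∣≡n∸∣p∣; ∣p∣≤n)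
open import Data.List.Extrema.Nat using (xs≤max)
open import Data.List.Membership.Propositional using () renaming (_∈_ to _∈ˡ_)
open import Data.List.Membership.Propositional.Properties using (∈-map⁺; ∈-++⁺ˡ; ∈-++⁺ʳ; ∈-filter⁺)
open import Data.List.Relation.Unary.All using () renaming (lookup to All-lookup)
open import Data.List.Relation.Unary.Any as Any using ()
open import Data.Nat using (ℕ; zero; suc; _+_; _∸_; _*_; _≤_; _<_; _≥_; z≤n; s≤s; s≤s⁻¹)
open import Data.Nat.Divisibility using (divides)
open import Data.Nat.DivMod using (m<n*o⇒m/o<n)
open import Data.Nat.Properties as ℕ using (≤-trans; ≤-reflexive; ≤-total)
open import Data.Nat.Tactic.RingSolver using (solve-∀)
open import Data.Product using (_×_; ∃-syntax; Σ-syntax; _,_; proj₁; proj₂)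
open import Data.Sum using (_⊎_; inj₁; inj₂)
open import Data.Vec.Base using ([]; _∷_; here; there; lookup; tabulate)
open import Data.Vec.Functional using (insertAt)
open import Data.Vec.Functional.Properties using (insertAt-lookup; insertAt-punchIn)
open import Data.Vec.Properties using (tabulate∘lookup; lookup∘tabulate; lookup⇒[]=; []=⇒lookup)
open import Function.Base using (_∘_)
open import Function.Bundles using (Equivalence)
open import Relation.Binary.PropositionalEquality using (_≡_; refl; sym; trans; cong; cong₂; subst; module ≡-Reasoning)
open import Relation.Nullary using (yes; no; does)

open import Algebra.Properties.Semiring.Sum (CommutativeRing.semiring xor-∧-commutativeRing)
  using (sum; sum-syntax; sum-cong-≗; sum-remove; sum-replicate-zero; ∑-distrib-+; *-distribˡ-sum)

private
  variable
    n : ℕ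

-- Symmetric linear systems over 𝔽₂.

Matrix : ℕ → Set
Matrix n = Fin n → Fin n → Bool

Symmetric : Matrix n → Set
Symmetric M = ∀ i j → M i j ≡ M j i

ZeroDiagonal : Matrix n → Set
ZeroDiagonal M = ∀ i → M i i ≡ false

∑-false : (f : Fin n → Bool) → (∀ i → f i ≡ false) → sum f ≡ false
∑-false {n} f f≗false = trans (sum-cong-≗ f≗false) (sum-replicate-zero n)

-- Over 𝔽₂ the product `r ∧ not s` is r + rs, so adding r to both sides of the hypothesis gives the
-- conclusion. It is the arithmetic of eliminating the pivot variable from another row.
xor-cancel-pivot : ∀ r s t m → t xor (r ∧ s) ≡ m xor r → (r ∧ not s) xor t ≡ m
xor-cancel-pivot false s     t     m     eq = trans (sym (xor-identityʳ t)) (trans eq (xor-identityʳ m))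
xor-cancel-pivot true  false false true  eq = refl
xor-cancel-pivot true  false true  false eq = refl
xor-cancel-pivot true  true  false false eq = refl
xor-cancel-pivot true  true  true  true  eq = refl
xor-cancel-pivot true  false false false ()
xor-cancel-pivot true  false true  true  ()
xor-cancel-pivot true  true  false true  ()
xor-cancel-pivot true  true  true  false ()

-- For a pivot `M p p` equal to 1 this is the Schur complement of that entry: over 𝔽₂ neither the
-- sign nor the inverse of the pivot shows. For symmetric M the correction term is the rank-one
-- matrix built from row p.
schur : (M : Matrix (suc n)) (p : Fin (suc n)) → Matrix n
schur M p i j = M (punchIn p i) (punchIn p j) xor (M p (punchIn p i) ∧ M p (punchIn p j))

module _ (M : Matrix (suc n)) (M-sym : Symmetric M) (p : Fin (suc n)) (Mpp : M p p ≡ true)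
         (y′ : Fin n → Bool) (y′-solves : ∀ i → ∑[ j < n ] (schur M p i j ∧ y′ j) ≡ schur M p i i) where
  private
    r : Fin n → Bool
    r j = M p (punchIn p j)

    N : Matrix n
    N i j = M (punchIn p i) (punchIn p j)

    s : Bool
    s = ∑[ j < n ] (r j ∧ y′ j)

  -- The pivot row reads y p + s = 1, which forces the value `not s` at p.
  back-substitute : Fin (suc n) → Bool
  back-substitute = insertAt y′ p (not s)

  private
    y = back-substitute

    expand : ∀ k → ∑[ j < suc n ] (M k j ∧ y j) ≡ (M k p ∧ not s) xor ∑[ j < n ] (M k (punchIn p j) ∧ y′ j)
    expand k = trans (sum-remove {i = p} (λ j → M k j ∧ y j))
      (cong₂ _xor_ (cong (M k p ∧_) (insertAt-lookup y′ p (not s)))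
                   (sum-cong-≗ λ j → cong (M k (punchIn p j) ∧_) (insertAt-punchIn y′ p (not s) j)))

    schur-row : ∀ i → ∑[ j < n ] (N i j ∧ y′ j) xor (r i ∧ s) ≡ N i i xor r i
    schur-row i = begin
      ∑[ j < n ] (N i j ∧ y′ j) xor (r i ∧ s)
        ≡⟨ cong (∑[ j < n ] (N i j ∧ y′ j) xor_) (*-distribˡ-sum (r i) (λ j → r j ∧ y′ j)) ⟩
      ∑[ j < n ] (N i j ∧ y′ j) xor ∑[ j < n ] (r i ∧ (r j ∧ y′ j))
        ≡⟨ ∑-distrib-+ (λ j → N i j ∧ y′ j) (λ j → r i ∧ (r j ∧ y′ j)) ⟨
      ∑[ j < n ] ((N i j ∧ y′ j) xor (r i ∧ (r j ∧ y′ j)))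
        ≡⟨ sum-cong-≗ (λ j → trans (∧-distribʳ-xor (y′ j) (N i j) (r i ∧ r j))
                                   (cong ((N i j ∧ y′ j) xor_) (∧-assoc (r i) (r j) (y′ j)))) ⟨
      ∑[ j < n ] (schur M p i j ∧ y′ j)
        ≡⟨ y′-solves i ⟩
      N i i xor (r i ∧ r i)
        -- Squaring is the identity on 𝔽₂. Hence the diagonal of the Schur complement is exactly
        -- what the right-hand side `diag M` becomes under elimination.
        ≡⟨ cong (N i i xor_) (∧-idem (r i)) ⟩
      N i i xor r i ∎
      where open ≡-Reasoning

    row-pivot : ∑[ j < suc n ] (M p j ∧ y j) ≡ M p p
    row-pivot = begin
      ∑[ j < suc n ] (M p j ∧ y j)  ≡⟨ expand p ⟩
      (M p p ∧ not s) xor s         ≡⟨ cong (λ b → (b ∧ not s) xor s) Mpp ⟩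
      not s xor s                   ≡⟨ xor-inverseˡ s ⟩
      true                          ≡⟨ Mpp ⟨
      M p p                         ∎
      where open ≡-Reasoning

    row-other : ∀ i → ∑[ j < suc n ] (M (punchIn p i) j ∧ y j) ≡ N i i
    row-other i = trans (expand (punchIn p i))
      -- Symmetry replaces the entry in the pivot column by the entry `r i` of the pivot row.
      (trans (cong (λ b → (b ∧ not s) xor ∑[ j < n ] (N i j ∧ y′ j)) (M-sym (punchIn p i) p))
             (xor-cancel-pivot (r i) s _ (N i i) (schur-row i)))

  back-substitute-solves : ∀ k → ∑[ j < suc n ] (M k j ∧ back-substitute j) ≡ M k k
  back-substitute-solves k with p Fin.≟ k
  ... | yes refl = row-pivot
  ... | no  p≢k  = subst (λ l → ∑[ j < suc n ] (M l j ∧ back-substitute j) ≡ M l l)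
                         (punchIn-punchOut p≢k) (row-other (punchOut p≢k))

-- Gaussian elimination: pivot on a nonzero diagonal entry and pass to the
-- Schur complement, which is again symmetric; with a zero diagonal, y = 0 works.
diagonal-in-image : (M : Matrix n) → Symmetric M →
                    Σ[ y ∈ (Fin n → Bool) ] ∀ i → ∑[ j < n ] (M i j ∧ y j) ≡ M i i
diagonal-in-image {zero}  M M-sym = (λ ()) , λ ()
diagonal-in-image {suc n} M M-sym with any? (λ i → M i i ≟ true)
... | no  all-zero = (λ _ → false) , λ i →
  trans (∑-false _ (λ j → ∧-zeroʳ (M i j))) (sym (¬-not (λ Mii → all-zero (i , Mii))))
... | yes (p , Mpp)
  with y′ , y′-solves ← diagonal-in-image (schur M p) (λ i j →
         cong₂ _xor_ (M-sym _ _) (∧-comm (M p (punchIn p i)) (M p (punchIn p j))))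
  = back-substitute M M-sym p Mpp y′ y′-solves , back-substitute-solves M M-sym p Mpp y′ y′-solves

-- The Kronecker delta, the handshake lemma and Gallai's theorem.

δ : Fin n → Fin n → Bool
δ i j = does (i Fin.≟ j)

δ-refl : (i : Fin n) → δ i i ≡ true
δ-refl zero    = refl
δ-refl (suc i) = δ-refl i

-- Both sides vanish off the diagonal. This is the symmetry of the diagonal matrix with entries f.
δ-∧-sym : (f : Fin n → Bool) (i j : Fin n) → δ i j ∧ f i ≡ δ j i ∧ f j
δ-∧-sym f zero    zero    = refl
δ-∧-sym f zero    (suc j) = refl
δ-∧-sym f (suc i) zero    = refl
δ-∧-sym f (suc i) (suc j) = δ-∧-sym (f ∘ suc) i j

∑-δ : (i : Fin n) (f : Fin n → Bool) → ∑[ j < n ] (δ i j ∧ f j) ≡ f i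
∑-δ {suc n} zero    f = trans (cong (f zero xor_) (sum-replicate-zero n)) (xor-identityʳ (f zero))
∑-δ {suc n} (suc i) f = ∑-δ i (f ∘ suc)

-- The entries at (i, j) and (j, i) cancel in characteristic 2. The induction strips the first row
-- together with the first column.
∑-symmetric : (B : Matrix n) → Symmetric B → ZeroDiagonal B →
              ∑[ i < n ] ∑[ j < n ] B i j ≡ false
∑-symmetric {zero}  B B-sym B-diag = refl
∑-symmetric {suc n} B B-sym B-diag = begin
  (B zero zero xor row) xor ∑[ i < n ] (B (suc i) zero xor ∑[ j < n ] B (suc i) (suc j))
    ≡⟨ cong₂ _xor_ (cong (_xor row) (B-diag zero))
                   (∑-distrib-+ (λ i → B (suc i) zero) (λ i → ∑[ j < n ] B (suc i) (suc j))) ⟩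
  row xor (∑[ i < n ] B (suc i) zero xor ∑[ i < n ] ∑[ j < n ] B (suc i) (suc j))
    ≡⟨ cong (row xor_) (cong₂ _xor_ (sum-cong-≗ λ i → B-sym (suc i) zero)
         (∑-symmetric (λ i j → B (suc i) (suc j)) (λ i j → B-sym _ _) (λ i → B-diag _))) ⟩
  row xor (row xor false)
    ≡⟨ cong (row xor_) (xor-identityʳ row) ⟩
  row xor row
    ≡⟨ xor-same row ⟩
  false ∎
  where
  open ≡-Reasoning
  row = ∑[ j < n ] B zero (suc j)

-- Vertex sets are characteristic functions; the parity of a set is its sum in
-- 𝔽₂, with true for odd.

degreeParity : Matrix n → (Fin n → Bool) → Fin n → Bool
degreeParity {n} A S v = ∑[ u < n ] (A v u ∧ S u)

DegreesOfParity : Bool → Matrix n → (Fin n → Bool) → Set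
DegreesOfParity p A S = ∀ v → S v ≡ true → degreeParity A S v ≡ p

degreeParity-xor : (A : Matrix n) (S R : Fin n → Bool) (v : Fin n) →
  degreeParity A (λ u → S u xor R u) v ≡ degreeParity A S v xor degreeParity A R v
degreeParity-xor A S R v = trans (sum-cong-≗ λ u → ∧-distribˡ-xor (A v u) (S u) (R u))
                                 (∑-distrib-+ (λ u → A v u ∧ S u) (λ u → A v u ∧ R u))

-- Weighting each vertex of S by its odd degree leaves the parity of S unchanged. The weighted sum
-- runs over ordered adjacent pairs within S, which cancel in twos.
handshake : (A : Matrix n) → Symmetric A → ZeroDiagonal A → (S : Fin n → Bool) →
            DegreesOfParity true A S → sum S ≡ false
handshake {n} A A-sym A-diag S S-odd = begin
  sum S                                          ≡⟨ sum-cong-≗ weight ⟩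
  ∑[ v < n ] (S v ∧ degreeParity A S v)          ≡⟨ sum-cong-≗ (λ v → *-distribˡ-sum (S v) (λ u → A v u ∧ S u)) ⟩
  ∑[ v < n ] ∑[ u < n ] (S v ∧ (A v u ∧ S u))    ≡⟨ ∑-symmetric _ B-sym B-diag ⟩
  false                                          ∎
  where
  open ≡-Reasoning

  weight : ∀ v → S v ≡ S v ∧ degreeParity A S v
  weight v with S v in Sv
  ... | false = refl
  ... | true  = sym (S-odd v Sv)

  B-sym : ∀ v u → S v ∧ (A v u ∧ S u) ≡ S u ∧ (A u v ∧ S v)
  B-sym v u = begin
    S v ∧ (A v u ∧ S u)  ≡⟨ ∧-comm (S v) _ ⟩
    (A v u ∧ S u) ∧ S v  ≡⟨ cong (_∧ S v) (∧-comm (A v u) (S u)) ⟩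
    (S u ∧ A v u) ∧ S v  ≡⟨ ∧-assoc (S u) (A v u) (S v) ⟩
    S u ∧ (A v u ∧ S v)  ≡⟨ cong (λ b → S u ∧ (b ∧ S v)) (A-sym v u) ⟩
    S u ∧ (A u v ∧ S v)  ∎

  B-diag : ∀ v → S v ∧ (A v v ∧ S v) ≡ false
  B-diag v = trans (cong (λ b → S v ∧ (b ∧ S v)) (A-diag v)) (∧-zeroʳ (S v))

-- Apply diagonal-in-image to A + diag(1 + deg): the support of y is the even part.
gallai : (A : Matrix n) → Symmetric A → ZeroDiagonal A →
         Σ[ y ∈ (Fin n → Bool) ] DegreesOfParity false A y × DegreesOfParity true A (not ∘ y)
gallai {n} A A-sym A-diag = y , y-even , not-y-odd
  where
  open ≡-Reasoning

  d : Fin n → Bool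
  d v = ∑[ u < n ] A v u

  M : Matrix n
  M v u = A v u xor (δ v u ∧ not (d v))

  solution = diagonal-in-image M λ v u → cong₂ _xor_ (A-sym v u) (δ-∧-sym (not ∘ d) v u)

  y : Fin n → Bool
  y = proj₁ solution

  -- Row v of the system. If v lies in y, the terms `not (d v)` cancel and the degree into y is
  -- even. Otherwise the degree into y is `not (d v)`, so the degree into the complement is
  -- `d v xor not (d v)`, which is odd.
  row : ∀ v → degreeParity A y v xor (not (d v) ∧ y v) ≡ not (d v)
  row v = begin
    degreeParity A y v xor (not (d v) ∧ y v)
      ≡⟨ cong (degreeParity A y v xor_) (∑-δ v (λ u → not (d v) ∧ y u)) ⟨
    degreeParity A y v xor ∑[ u < n ] (δ v u ∧ (not (d v) ∧ y u))
      ≡⟨ ∑-distrib-+ (λ u → A v u ∧ y u) (λ u → δ v u ∧ (not (d v) ∧ y u)) ⟨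
    ∑[ u < n ] ((A v u ∧ y u) xor (δ v u ∧ (not (d v) ∧ y u)))
      ≡⟨ sum-cong-≗ (λ u → trans (∧-distribʳ-xor (y u) (A v u) (δ v u ∧ not (d v)))
                                 (cong ((A v u ∧ y u) xor_) (∧-assoc (δ v u) (not (d v)) (y u)))) ⟨
    ∑[ u < n ] (M v u ∧ y u)
      ≡⟨ proj₂ solution v ⟩
    A v v xor (δ v v ∧ not (d v))
      ≡⟨ cong₂ (λ a b → a xor (b ∧ not (d v))) (A-diag v) (δ-refl v) ⟩
    not (d v) ∎

  xor-fixed : ∀ a b → a xor (b ∧ true) ≡ b → a ≡ false
  xor-fixed false b     eq = refl
  xor-fixed true  false ()
  xor-fixed true  true  ()

  y-even : DegreesOfParity false A y
  y-even v yv = xor-fixed _ (not (d v)) (subst (λ b → degreeParity A y v xor (not (d v) ∧ b) ≡ not (d v)) yv (row v))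

  not-y-odd : DegreesOfParity true A (not ∘ y)
  not-y-odd v ¬yv = begin
    degreeParity A (not ∘ y) v
      ≡⟨ degreeParity-xor A (λ _ → true) y v ⟩
    degreeParity A (λ _ → true) v xor degreeParity A y v
      ≡⟨ cong₂ _xor_ (sum-cong-≗ λ u → ∧-identityʳ (A v u)) outside-y ⟩
    d v xor not (d v)
      ≡⟨ xor-inverseʳ (d v) ⟩
    true ∎
    where
    yv : y v ≡ false
    yv = trans (sym (not-involutive (y v))) (cong not ¬yv)

    outside-y : degreeParity A y v ≡ not (d v)
    outside-y = begin
      degreeParity A y v                           ≡⟨ xor-identityʳ _ ⟨
      degreeParity A y v xor false                 ≡⟨ cong (degreeParity A y v xor_) (∧-zeroʳ (not (d v))) ⟨
      degreeParity A y v xor (not (d v) ∧ false)   ≡⟨ cong (λ b → degreeParity A y v xor (not (d v) ∧ b)) yv ⟨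
      degreeParity A y v xor (not (d v) ∧ y v)     ≡⟨ row v ⟩
      not (d v)                                    ∎

-- Even and odd parts of an odd set, and their unions across a join.

∧-trueˡ : ∀ {a b} → a ∧ b ≡ true → a ≡ true
∧-trueˡ {true} _ = refl

∧-trueʳ : ∀ {a b} → a ∧ b ≡ true → b ≡ true
∧-trueʳ {true} eq = eq

∧-complement : ∀ a b → (a ∧ b) xor (a ∧ not b) ≡ a
∧-complement false b     = refl
∧-complement true  false = refl
∧-complement true  true  = refl

∧-disjoint : ∀ a b → (a ∧ b) ∧ (a ∧ not b) ≡ false
∧-disjoint false b     = refl
∧-disjoint true  false = refl
∧-disjoint true  true  = refl

-- For v in w, deleting the edges that are not within w has the same effect on the degree of v as
-- intersecting S with w. Gallai's theorem can thus be applied to the subgraph on w without leaving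
-- the vertex type `Fin n`.
DegreesOfParity-restrict : ∀ {p} (A : Matrix n) (w S : Fin n → Bool) →
  DegreesOfParity p (λ v u → A v u ∧ (w v ∧ w u)) S → DegreesOfParity p A (λ u → w u ∧ S u)
DegreesOfParity-restrict A w S S-deg v wSv = trans
  (sum-cong-≗ λ u → begin
    A v u ∧ (w u ∧ S u)            ≡⟨ ∧-assoc (A v u) (w u) (S u) ⟨
    (A v u ∧ w u) ∧ S u            ≡⟨ cong (λ b → (A v u ∧ (b ∧ w u)) ∧ S u) (∧-trueˡ wSv) ⟨
    (A v u ∧ (w v ∧ w u)) ∧ S u    ∎)
  (S-deg v (∧-trueʳ {w v} wSv))
  where open ≡-Reasoning

-- A Gallai partition of w. The union is written with `xor` because that is linear over 𝔽₂;
-- `disjoint` makes it additive for cardinalities as well.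
record OddSplit (A : Matrix n) (w : Fin n → Bool) : Set where
  field
    E O      : Fin n → Bool
    cover    : ∀ u → w u ≡ E u xor O u
    disjoint : ∀ u → E u ∧ O u ≡ false
    E⊆w      : ∀ u → E u ≡ true → w u ≡ true
    O⊆w      : ∀ u → O u ≡ true → w u ≡ true
    E-even   : DegreesOfParity false A E
    O-odd    : DegreesOfParity true A O
    ∣E∣-odd  : sum E ≡ true
    ∣O∣-even : sum O ≡ false

oddSplit : (A : Matrix n) → Symmetric A → ZeroDiagonal A →
           (w : Fin n → Bool) → sum w ≡ true → OddSplit A w
oddSplit {n} A A-sym A-diag w w-odd = record
  { E        = λ u → w u ∧ y u
  ; O        = O
  ; cover    = λ u → sym (∧-complement (w u) (y u))
  ; disjoint = λ u → ∧-disjoint (w u) (y u)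
  ; E⊆w      = λ u → ∧-trueˡ
  ; O⊆w      = λ u → ∧-trueˡ
  ; E-even   = DegreesOfParity-restrict A w y (proj₁ (proj₂ partition))
  ; O-odd    = O-odd
  ; ∣E∣-odd  = begin
      sum (λ u → w u ∧ y u)             ≡⟨ xor-identityʳ _ ⟨
      sum (λ u → w u ∧ y u) xor false   ≡⟨ cong (sum (λ u → w u ∧ y u) xor_) ∣O∣-even ⟨
      sum (λ u → w u ∧ y u) xor sum O   ≡⟨ ∑-distrib-+ (λ u → w u ∧ y u) O ⟨
      ∑[ u < n ] ((w u ∧ y u) xor O u)  ≡⟨ sum-cong-≗ (λ u → ∧-complement (w u) (y u)) ⟩
      sum w                             ≡⟨ w-odd ⟩
      true                              ∎
  ; ∣O∣-even = ∣O∣-even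
  }
  where
  open ≡-Reasoning

  -- Vertices outside w are isolated in this graph, so they end up in the even part y, and E has to
  -- be cut back to w.
  partition = gallai (λ v u → A v u ∧ (w v ∧ w u))
    (λ v u → cong₂ _∧_ (A-sym v u) (∧-comm (w v) (w u)))
    (λ v → cong (_∧ (w v ∧ w v)) (A-diag v))

  y O : Fin n → Bool
  y = proj₁ partition
  O u = w u ∧ not (y u)

  O-odd : DegreesOfParity true A O
  O-odd = DegreesOfParity-restrict A w (not ∘ y) (proj₂ (proj₂ partition))

  ∣O∣-even : sum O ≡ false
  ∣O∣-even = handshake A A-sym A-diag O O-odd

xor-true : ∀ a b → a xor b ≡ true → a ≡ true ⊎ b ≡ true
xor-true true  b eq = inj₁ refl
xor-true false b eq = inj₂ eq

degreeParity-complete : (A : Matrix n) (S : Fin n → Bool) (v : Fin n) →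
  (∀ u → S u ≡ true → A v u ≡ true) → degreeParity A S v ≡ sum S
degreeParity-complete A S v complete = sum-cong-≗ λ u → pointwise u
  where
  pointwise : ∀ u → A v u ∧ S u ≡ S u
  pointwise u with S u in Su
  ... | false = ∧-zeroʳ (A v u)
  ... | true  = trans (∧-identityʳ (A v u)) (complete u Su)

-- Modulo 2, a vertex of S has p neighbours in S and, being joined to all of R, `not p` neighbours
-- in R; these add up to 1. The case `false` serves the even parts, of odd size, and the case `true`
-- the odd parts, of even size.
join-odd : (A : Matrix n) → Symmetric A → (S R : Fin n → Bool) →
  (∀ v u → S v ≡ true → R u ≡ true → A v u ≡ true) →
  ∀ p → DegreesOfParity p A S → DegreesOfParity p A R → sum S ≡ not p → sum R ≡ not p →
  DegreesOfParity true A (λ u → S u xor R u)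
join-odd A A-sym S R complete p S-deg R-deg ∣S∣ ∣R∣ v v∈S∪R
  with xor-true (S v) (R v) v∈S∪R
... | inj₁ v∈S = trans (degreeParity-xor A S R v) (trans
  (cong₂ _xor_ (S-deg v v∈S) (trans (degreeParity-complete A R v (λ u → complete v u v∈S)) ∣R∣))
  (xor-inverseʳ p))
... | inj₂ v∈R = trans (degreeParity-xor A S R v) (trans
  (cong₂ _xor_ (trans (degreeParity-complete A S v (λ u u∈S → trans (A-sym v u) (complete u v u∈S v∈R))) ∣S∣)
               (R-deg v v∈R))
  (xor-inverseˡ p))

-- Cardinalities and their parities.

count : (Fin n → Bool) → ℕ
count S = ∣ tabulate S ∣

odd : ℕ → Bool
odd zero    = false
odd (suc k) = not (odd k)

odd-count : (S : Fin n → Bool) → odd (count S) ≡ sum S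
odd-count {zero}  S = refl
odd-count {suc n} S with S zero
... | false = odd-count (S ∘ suc)
... | true  = cong not (odd-count (S ∘ suc))

odd-*2 : ∀ q → odd (q * 2) ≡ false
odd-*2 zero    = refl
odd-*2 (suc q) = trans (not-involutive _) (odd-*2 q)

odd⇒Odd : ∀ k → odd k ≡ true → Odd k
odd⇒Odd k k-odd (divides q refl) with () ← trans (sym k-odd) (odd-*2 q)

even⇒double : ∀ k → odd k ≡ false → ∃[ t ] k ≡ 2 * t
even⇒double zero          _    = 0 , refl
even⇒double (suc (suc k)) even with even⇒double k (trans (sym (not-involutive (odd k))) even)
... | t , refl = suc t , solve-double t
  where
  solve-double : ∀ t → suc (suc (2 * t)) ≡ 2 * suc t
  solve-double = solve-∀

count-disjoint : (f g h : Fin n → Bool) → (∀ u → h u ≡ f u xor g u) → (∀ u → f u ∧ g u ≡ false) →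
                 count h ≡ count f + count g
count-disjoint {zero}  f g h h≗f+g f∧g = refl
count-disjoint {suc n} f g h h≗f+g f∧g
  with IH ← count-disjoint (f ∘ suc) (g ∘ suc) (h ∘ suc) (h≗f+g ∘ suc) (f∧g ∘ suc)
  with f zero | g zero | h zero | h≗f+g zero | f∧g zero
... | false | false | .false | refl | _ = IH
... | false | true  | .true  | refl | _ = trans (cong suc IH) (sym (ℕ.+-suc _ _))
... | true  | false | .true  | refl | _ = cong suc IH

count-false : ∀ n → count {n} (λ _ → false) ≡ 0
count-false zero    = refl
count-false (suc n) = count-false n

count-δ : (x : Fin n) (f : Fin n → Bool) → count (λ u → δ x u ∧ f u) ≤ 1
count-δ {suc n} zero f with f zero
... | false = ≤-trans (≤-reflexive (count-false n)) z≤n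
... | true  = s≤s (≤-reflexive (count-false n))
count-δ (suc x) f = count-δ x (f ∘ suc)

-- A set of even size becomes odd when x is removed. Doing this on both sides of a join costs at
-- most two vertices, whence the n - 2 in the bound.
oddSubset : (f : Fin n → Bool) (x : Fin n) → f x ≡ true →
  Σ[ w ∈ (Fin n → Bool) ] (∀ u → w u ≡ true → f u ≡ true) × sum w ≡ true × count f ≤ count w + 1
oddSubset {n} f x fx with sum f in f-parity
... | true  = f , (λ u fu → fu) , f-parity , ℕ.m≤m+n _ 1
... | false = w , (λ u → ∧-trueʳ) , w-odd , f≤w+1
  where
  w : Fin n → Bool
  w u = not (δ x u) ∧ f u

  split : ∀ b c → c ≡ (not b ∧ c) xor (b ∧ c)
  split false c = sym (xor-identityʳ c)
  split true  c = refl

  disjoint : ∀ b c → (not b ∧ c) ∧ (b ∧ c) ≡ false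
  disjoint false c = ∧-zeroʳ c
  disjoint true  c = refl

  w-odd : sum w ≡ true
  -- By computation `not (δ x u)` is `true xor δ x u`, so w is f plus the indicator of x, and the
  -- parity flips.
  w-odd = trans (sum-cong-≗ λ u → ∧-distribʳ-xor (f u) true (δ x u))
    (trans (∑-distrib-+ f (λ u → δ x u ∧ f u)) (cong₂ _xor_ f-parity (trans (∑-δ x f) fx)))

  f≤w+1 : count f ≤ count w + 1
  f≤w+1 = ≤-trans
    (≤-reflexive (count-disjoint w (λ u → δ x u ∧ f u) f (λ u → split (δ x u) (f u)) (λ u → disjoint (δ x u) (f u))))
    (ℕ.+-monoʳ-≤ (count w) (count-δ x f))

-- From characteristic functions to induced subgraphs and `mos`.

lookup-element : (S : Subset n) (i : Fin ∣ S ∣) → lookup S (element S i) ≡ true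
lookup-element (outside ∷ S) i       = lookup-element S i
lookup-element (inside  ∷ S) zero    = refl
lookup-element (inside  ∷ S) (suc i) = lookup-element S i

-- Since `element S` enumerates S, this turns degrees in `induced G S`, whose vertices are
-- renumbered, into values of `degreeParity`.
∑-element : (S : Subset n) (f : Fin n → Bool) →
            ∑[ i < ∣ S ∣ ] f (element S i) ≡ ∑[ u < n ] (f u ∧ lookup S u)
∑-element []            f = refl
∑-element (outside ∷ S) f = trans (∑-element S (f ∘ suc)) (cong (_xor ∑[ u < _ ] (f (suc u) ∧ lookup S u)) (sym (∧-zeroʳ (f zero))))
∑-element (inside  ∷ S) f = cong₂ _xor_ (sym (∧-identityʳ (f zero))) (∑-element S (f ∘ suc))

∈-allSubsets : (S : Subset n) → S ∈ˡ allSubsets n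
∈-allSubsets []            = Any.here refl
∈-allSubsets (outside ∷ S) = ∈-++⁺ˡ (∈-map⁺ (outside ∷_) (∈-allSubsets S))
∈-allSubsets (inside  ∷ S) = ∈-++⁺ʳ _ (∈-map⁺ (inside ∷_) (∈-allSubsets S))

∣S∣≤mos : (G : Graph n) (S : Subset n) → OddGraph (induced G S) → ∣ S ∣ ≤ mos G
∣S∣≤mos G S S-odd = All-lookup (xs≤max 0 _)
  (∈-map⁺ ∣_∣ (∈-filter⁺ (λ S → oddGraph? (induced G S)) (∈-allSubsets S) S-odd))

count≤mos : (G : Graph n) (S : Fin n → Bool) → DegreesOfParity true (adj G) S → count S ≤ mos G
count≤mos G S S-odd = ∣S∣≤mos G (tabulate S) λ i →
  odd⇒Odd _ (begin
    odd (degree (induced G (tabulate S)) i)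
      -- The degree unfolds to `count` of a row of the induced adjacency matrix.
      ≡⟨ odd-count (λ j → adj G (v i) (v j)) ⟩
    sum (λ j → adj G (v i) (v j))
      ≡⟨ ∑-element (tabulate S) (adj G (v i)) ⟩
    sum (λ u → adj G (v i) u ∧ lookup (tabulate S) u)
      ≡⟨ sum-cong-≗ (λ u → cong (adj G (v i) u ∧_) (lookup∘tabulate S u)) ⟩
    degreeParity (adj G) S (v i)
      ≡⟨ S-odd (v i) (trans (sym (lookup∘tabulate S (v i))) (lookup-element (tabulate S) i)) ⟩
    true ∎)
  where
  open ≡-Reasoning
  v = element (tabulate S)

-- By the handshake lemma S has even size 2t, so n - 2 is at most 4t and the ceiling is at most t.
-- The evenness of S is what yields the factor 2 outside the ceiling.
half≤count⇒bound≤mos : (G : Graph n) (S : Fin n → Bool) → DegreesOfParity true (adj G) S →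
  n ∸ 2 ≤ count S + count S → 2 * ⌈ (n ∸ 2) / 4 ⌉ ≤ mos G
half≤count⇒bound≤mos {n} G S S-odd n-2≤2S
  with t , ∣S∣≡2t ← even⇒double (count S)
         (trans (odd-count S) (handshake (adj G) (adj-sym G) (adj-irrefl G) S S-odd))
  = begin
    2 * ⌈ (n ∸ 2) / 4 ⌉  ≤⟨ ℕ.*-monoʳ-≤ 2 (s≤s⁻¹ (m<n*o⇒m/o<n {n = suc t} n-2+3<4t+4)) ⟩
    2 * t                ≡⟨ ∣S∣≡2t ⟨
    count S              ≤⟨ count≤mos G S S-odd ⟩
    mos G                ∎
  where
  open ℕ.≤-Reasoning

  four : ∀ t → suc ((2 * t + 2 * t) + 3) ≡ suc t * 4
  four = solve-∀

  -- The 3 is the summand by which the ceiling is reduced to a floor division by 4.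
  n-2+3<4t+4 : n ∸ 2 + 3 < suc t * 4
  n-2+3<4t+4 = begin
    suc (n ∸ 2 + 3)              ≤⟨ s≤s (ℕ.+-monoˡ-≤ 3 n-2≤2S) ⟩
    suc (count S + count S + 3)  ≡⟨ cong (λ k → suc (k + k + 3)) ∣S∣≡2t ⟩
    suc (2 * t + 2 * t + 3)      ≡⟨ four t ⟩
    suc t * 4                    ∎

halves⇒bound≤mos : (G : Graph n) (S R : Fin n → Bool) →
  DegreesOfParity true (adj G) S → DegreesOfParity true (adj G) R →
  n ∸ 2 ≤ count S + count R → 2 * ⌈ (n ∸ 2) / 4 ⌉ ≤ mos G
halves⇒bound≤mos G S R S-odd R-odd n-2≤S+R with ≤-total (count S) (count R)
... | inj₁ S≤R = half≤count⇒bound≤mos G R R-odd (≤-trans n-2≤S+R (ℕ.+-monoˡ-≤ (count R) S≤R))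
... | inj₂ R≤S = half≤count⇒bound≤mos G S S-odd (≤-trans n-2≤S+R (ℕ.+-monoʳ-≤ (count S) R≤S))

-- The lower bound for a graph with a join.

module _ (G : Graph n) (V : Subset n) (x∈V : Nonempty V) (z∈∁V : Nonempty (∁ V))
         (join : ∀ {u v} → u ∈ V → v ∈ ∁ V → Adj G u v) where
  private
    A = adj G

    f g : Fin n → Bool
    f = lookup V
    g = lookup (∁ V)

    complete : ∀ u v → f u ≡ true → g v ≡ true → A u v ≡ true
    complete u v fu gv = Equivalence.to T-≡ (join (lookup⇒[]= u V fu) (lookup⇒[]= v (∁ V) gv))

    f∧g : ∀ u → f u ∧ g u ≡ false
    f∧g u with f u in fu | g u in gu
    ... | false | _     = refl
    ... | true  | false = refl
    -- A vertex on both sides would be adjacent to itself.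
    ... | true  | true  = trans (sym (complete u u fu gu)) (adj-irrefl G u)

    n≡f+g : n ≡ count f + count g
    n≡f+g = begin
      n                  ≡⟨ ℕ.m+[n∸m]≡n (∣p∣≤n V) ⟨
      ∣ V ∣ + (n ∸ ∣ V ∣)  ≡⟨ cong (∣ V ∣ +_) (∣∁p∣≡n∸∣p∣ V) ⟨
      ∣ V ∣ + ∣ ∁ V ∣      ≡⟨ cong₂ _+_ (cong ∣_∣ (tabulate∘lookup V)) (cong ∣_∣ (tabulate∘lookup (∁ V))) ⟨
      count f + count g  ∎
      where open ≡-Reasoning

    side₁ = oddSubset f (proj₁ x∈V) ([]=⇒lookup (proj₂ x∈V))
    side₂ = oddSubset g (proj₁ z∈∁V) ([]=⇒lookup (proj₂ z∈∁V))

    w₁ w₂ : Fin n → Bool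
    w₁ = proj₁ side₁
    w₂ = proj₁ side₂

    w₁⊆f = proj₁ (proj₂ side₁)
    w₂⊆g = proj₁ (proj₂ side₂)

    module P₁ = OddSplit (oddSplit A (adj-sym G) (adj-irrefl G) w₁ (proj₁ (proj₂ (proj₂ side₁))))
    module P₂ = OddSplit (oddSplit A (adj-sym G) (adj-irrefl G) w₂ (proj₁ (proj₂ (proj₂ side₂))))

    S R : Fin n → Bool
    S u = P₁.E u xor P₂.E u
    R u = P₁.O u xor P₂.O u

    S-odd : DegreesOfParity true A S
    S-odd = join-odd A (adj-sym G) P₁.E P₂.E
      (λ v u v∈ u∈ → complete v u (w₁⊆f v (P₁.E⊆w v v∈)) (w₂⊆g u (P₂.E⊆w u u∈)))
      false P₁.E-even P₂.E-even P₁.∣E∣-odd P₂.∣E∣-odd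

    R-odd : DegreesOfParity true A R
    R-odd = join-odd A (adj-sym G) P₁.O P₂.O
      (λ v u v∈ u∈ → complete v u (w₁⊆f v (P₁.O⊆w v v∈)) (w₂⊆g u (P₂.O⊆w u u∈)))
      true P₁.O-odd P₂.O-odd P₁.∣O∣-even P₂.∣O∣-even

    separate : (h k : Fin n → Bool) → (∀ u → h u ≡ true → f u ≡ true) → (∀ u → k u ≡ true → g u ≡ true) →
               count (λ u → h u xor k u) ≡ count h + count k
    separate h k h⊆f k⊆g = count-disjoint h k _ (λ _ → refl) h∧k
      where
      h∧k : ∀ u → h u ∧ k u ≡ false
      h∧k u with h u in hu | k u in ku
      ... | false | _     = refl
      ... | true  | false = refl
      ... | true  | true  = trans (sym (cong₂ _∧_ (h⊆f u hu) (k⊆g u ku))) (f∧g u)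

    rearrange : ∀ a b c d → (a + b + 1) + (c + d + 1) ≡ 2 + ((a + c) + (b + d))
    rearrange = solve-∀

    n-2≤S+R : n ∸ 2 ≤ count S + count R
    n-2≤S+R = ℕ.m≤n+o⇒m∸n≤o n 2 (begin
      n
        ≡⟨ n≡f+g ⟩
      count f + count g
        ≤⟨ ℕ.+-mono-≤ (proj₂ (proj₂ (proj₂ side₁))) (proj₂ (proj₂ (proj₂ side₂))) ⟩
      (count w₁ + 1) + (count w₂ + 1)
        ≡⟨ cong₂ (λ a b → (a + 1) + (b + 1)) (count-disjoint P₁.E P₁.O w₁ P₁.cover P₁.disjoint)
                                             (count-disjoint P₂.E P₂.O w₂ P₂.cover P₂.disjoint) ⟩
      (count P₁.E + count P₁.O + 1) + (count P₂.E + count P₂.O + 1)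
        ≡⟨ rearrange (count P₁.E) (count P₁.O) (count P₂.E) (count P₂.O) ⟩
      2 + ((count P₁.E + count P₂.E) + (count P₁.O + count P₂.O))
        ≡⟨ cong (2 +_) (cong₂ _+_
             (separate P₁.E P₂.E (λ u → w₁⊆f u ∘ P₁.E⊆w u) (λ u → w₂⊆g u ∘ P₂.E⊆w u))
             (separate P₁.O P₂.O (λ u → w₁⊆f u ∘ P₁.O⊆w u) (λ u → w₂⊆g u ∘ P₂.O⊆w u))) ⟨
      2 + (count S + count R) ∎)
      where open ℕ.≤-Reasoning

  join-bound : 2 * ⌈ (n ∸ 2) / 4 ⌉ ≤ mos G
  join-bound = halves⇒bound≤mos G S R S-odd R-odd n-2≤S+R

-- Tightness.

triangle : Graph 3
triangle = record
  { adj        = λ u v → not (δ u v)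
  ; adj-sym    = λ u v → cong not (trans (sym (∧-identityʳ _)) (trans (δ-∧-sym (λ _ → true) u v) (∧-identityʳ _)))
  ; adj-irrefl = λ v → cong not (δ-refl v)
  }

-- Three vertices are too few for an induced path on four.
triangle-cograph : Cograph triangle
triangle-cograph (f , f-injective , _) with i , j , i<j , fi≡fj ← pigeonhole ℕ.≤-refl f =
  Fin.<⇒≢ i<j (f-injective fi≡fj)

triangle-join : AdmitsJoin triangle
triangle-join = V , ∁ V , refl , (zero , here) , (suc zero , there here) , adjacent
  where
  V : Subset 3
  V = inside ∷ outside ∷ outside ∷ []

  adjacent : ∀ {u v} → u ∈ V → v ∈ ∁ V → Adj triangle u v
  adjacent here              (there _) = _
  adjacent (there (there (there ()))) _

theorem8 : ((n : ℕ) (G : Graph n) → AdmitsJoin G → mos G ≥ 2 * ⌈ (n ∸ 2) / 4 ⌉)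
    × (∃[ n ] Σ[ G ∈ Graph n ] Cograph G × AdmitsJoin G × mos G ≡ 2 * ⌈ (n ∸ 2) / 4 ⌉)
theorem8 =
  (λ { n G (V , .(∁ V) , refl , x∈V , z∈∁V , join) → join-bound G V x∈V z∈∁V join }) ,
  -- Both sides evaluate to 2: the ceiling of 1/4 is 1, an edge is an odd graph, and in the whole
  -- triangle all degrees are 2.
  3 , triangle , triangle-cograph , triangle-join , refl
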